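{- There exist an S4 theorem $A$ and an LP formula $B$ such that $A$ has no prehistoric-cycle-free G3s proof, $B^\circ = A$, and $\mathrm{LP}(\mathrm{CS}^\odot)\vdash B$. Specifically, one may take $A := \Box(P\land\lnot\Box P\to P)\to\lnot\Box(P\land\lnot\Box P)$ and $B := y{:}(P\land\lnot (y\cdot x){:}P\to P)\to\lnot x{:}(P\land\lnot (y\cdot x){:}P)$, for an atom $P$ and distinct variables $x,y$.
   Context: LP terms: $t ::= c \mid x \mid t_0\cdot t_1 \mid t_0+t_1 \mid\ !t$; LP formulas: $A ::= \bot \mid P \mid A_0\to A_1 \mid t{:}A$; $\lnot A := A\to\bot$, $\land$ a classical abbreviation. LP: axioms A0 (classical propositional schemes), A1 $t{:}F\to F$, A2 $s{:}(F\to G)\to(t{:}F\to(s\cdot t){:}G)$, A3 $t{:}F\to\ !t{:}(t{:}F)$, A4 $s{:}F\to(s+t){:}F$, $t{:}F\to(s+t){:}F$; rules modus ponens and axiom necessitation ($A\vdash c{:}A$ for $A$ an axiom, $c$ a constant). A constant specification CS is a set of formulas $c{:}A$ with $c$ a constant and $A$ an axiom; LP(CS) restricts axiom necessitation to members of CS. CS is self-referential if there are $c_0{:}A_0,\dots,c_{n-1}{:}A_{n-1}\in\mathrm{CS}$ ($n\ge1$) with $c_{(k+1)\bmod n}$ occurring in $A_k$ for all $k$. $\mathrm{LP}(\mathrm{CS}^\odot)\vdash B$ means $\mathrm{LP}(\mathrm{CS})\vdash B$ for some non-self-referential CS. Forgetful projection: $(t{:}A)^\circ=\Box A^\circ$,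 commuting with $\to$, atoms, $\bot$. G3s is the cut-free sequent calculus for S4 with rules (Ax) $P,\Gamma\supset\Delta,P$; $(\bot\supset)$; $(\to\supset)$; $(\supset\to)$; $(\Box\supset)$ from $A,\Box A,\Gamma\supset\Delta$ infer $\Box A,\Gamma\supset\Delta$; $(\supset\Box)$ from $\Box\Gamma\supset A$ infer $\Gamma',\Box\Gamma\supset\Delta',\Box A$ (plus standard rules for $\lnot,\land$ if these are primitive). Families are equivalence classes of $\Box$-occurrences under correspondence (side-formula occurrences correspond from premise to conclusion; active formulas correspond to their topmost occurrence as subformula of the principal formula, symbolwise; closed reflexively, symmetrically, transitively). $i\prec j$ if some $(\supset\Box)$ rule whose principal $\Box A$ has outermost $\Box$ in family $j$ has a premise containing a $\Box$ of family $i$; a G3s proof is prehistoric-cycle-free if there is no $i_0\prec\cdots\prec i_{n-1}\prec i_0$ ($n\ge1$). A G3s proof of $A$ means a proof of the sequent $\supset A$. -}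

module Defs where

open import Data.Fin using (Fin; toℕ)
open import Data.List using (List; []; _∷_; [_]; map; _++_)
open import Data.List.Relation.Binary.Permutation.Propositional using (_↭_)
open import Data.List.Relation.Binary.Permutation.Propositional.Properties using (Any-resp-↭)
open import Data.List.Relation.Unary.Any using (Any; here; there)
open import Data.List.Relation.Unary.Any.Properties using (++⁺ʳ)
open import Data.Nat using (ℕ; suc)
open import Data.Nat.DivMod using (_mod_)
open import Data.Product using (Σ; Σ-syntax; ∃-syntax; _×_; _,_)
open import Data.Sum using (_⊎_; inj₁; inj₂)
open import Relation.Binary.Construct.Closure.Equivalence using (EqClosure)
open import Relation.Binary.PropositionalEquality using (_≡_)
open import Relation.Nullary using (¬_)

Atom Var Const : Set
Atom  = ℕ
Var   = ℕ
Const = ℕ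

-- i₀ R i₁ R ⋯ R iₙ₋₁ R i₀ with n = suc m ≥ 1.
Cycle : {I : Set} → (I → I → Set) → Set
Cycle {I} R =
  Σ[ m ∈ ℕ ] Σ[ i ∈ (Fin (suc m) → I) ]
    ((k : Fin (suc m)) → R (i k) (i (suc (toℕ k) mod suc m)))

data ClassicalAxiom {F : Set} (_⟶_ : F → F → F) (⊥ : F) : F → Set where
  ax-K   : ∀ A B → ClassicalAxiom _⟶_ ⊥ (A ⟶ (B ⟶ A))
  ax-S   : ∀ A B C →
           ClassicalAxiom _⟶_ ⊥ ((A ⟶ (B ⟶ C)) ⟶ ((A ⟶ B) ⟶ (A ⟶ C)))
  ax-DNE : ∀ A → ClassicalAxiom _⟶_ ⊥ (((A ⟶ ⊥) ⟶ ⊥) ⟶ A)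

------------------------------------------------------------------------
-- Modal logic S4

infixr 6 _⇒_
infixr 7 _∧ᴹ_
infixr 8 □_ ¬ᴹ_

data MFm : Set where
  ⊥ᶠ   : MFm
  atom : Atom → MFm
  _⇒_  : MFm → MFm → MFm
  □_   : MFm → MFm

¬ᴹ_ : MFm → MFm
¬ᴹ A = A ⇒ ⊥ᶠ

_∧ᴹ_ : MFm → MFm → MFm
A ∧ᴹ B = ¬ᴹ (A ⇒ ¬ᴹ B)

infix 2 S4⊢_

data S4⊢_ : MFm → Set where
  classical : ∀ {A} → ClassicalAxiom _⇒_ ⊥ᶠ A → S4⊢ A
  distr     : ∀ A B → S4⊢ □ (A ⇒ B) ⇒ (□ A ⇒ □ B)
  refl      : ∀ A → S4⊢ □ A ⇒ A
  trans     : ∀ A → S4⊢ □ A ⇒ □ □ A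
  mp        : ∀ {A B} → S4⊢ A ⇒ B → S4⊢ A → S4⊢ B
  nec       : ∀ {A} → S4⊢ A → S4⊢ □ A

------------------------------------------------------------------------
-- The sequent calculus G3s

infix 4 _⊃_

record Sequent : Set where
  constructor _⊃_
  field
    antecedent succedent : List MFm

-- The two sides of a sequent are multisets.  They are represented by lists,
-- and `exch` passes between lists representing the same multisets.
data G3s : Sequent → Set where
  ax   : ∀ {p Γ Δ} → G3s (atom p ∷ Γ ⊃ atom p ∷ Δ)
  ⊥L   : ∀ {Γ Δ} → G3s (⊥ᶠ ∷ Γ ⊃ Δ)
  ⇒L   : ∀ {A B Γ Δ} → G3s (Γ ⊃ A ∷ Δ) → G3s (B ∷ Γ ⊃ Δ) → G3s (A ⇒ B ∷ Γ ⊃ Δ)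
  ⇒R   : ∀ {A B Γ Δ} → G3s (A ∷ Γ ⊃ B ∷ Δ) → G3s (Γ ⊃ A ⇒ B ∷ Δ)
  □L   : ∀ {A Γ Δ} → G3s (A ∷ □ A ∷ Γ ⊃ Δ) → G3s (□ A ∷ Γ ⊃ Δ)
  □R   : ∀ {A} Γ′ Γ Δ′ →
         G3s (map □_ Γ ⊃ [ A ]) → G3s (Γ′ ++ map □_ Γ ⊃ □ A ∷ Δ′)
  exch : ∀ {Γ Γ′ Δ Δ′} → Γ ↭ Γ′ → Δ ↭ Δ′ → G3s (Γ ⊃ Δ) → G3s (Γ′ ⊃ Δ′)

G3sProof : MFm → Set
G3sProof A = G3s ([] ⊃ [ A ])

data Premise : ∀ {S′ S} → G3s S′ → G3s S → Set where
  ⇒L₁  : ∀ {A B Γ Δ} {π₁ : G3s (Γ ⊃ A ∷ Δ)} {π₂ : G3s (B ∷ Γ ⊃ Δ)} →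
         Premise π₁ (⇒L π₁ π₂)
  ⇒L₂  : ∀ {A B Γ Δ} {π₁ : G3s (Γ ⊃ A ∷ Δ)} {π₂ : G3s (B ∷ Γ ⊃ Δ)} →
         Premise π₂ (⇒L π₁ π₂)
  ⇒R   : ∀ {A B Γ Δ} {π : G3s (A ∷ Γ ⊃ B ∷ Δ)} → Premise π (⇒R π)
  □L   : ∀ {A Γ Δ} {π : G3s (A ∷ □ A ∷ Γ ⊃ Δ)} → Premise π (□L π)
  □R   : ∀ {A Γ′ Γ Δ′} {π : G3s (map □_ Γ ⊃ [ A ])} →
         Premise π (□R Γ′ Γ Δ′ π)
  exch : ∀ {Γ Γ′ Δ Δ′} {σ : Γ ↭ Γ′} {τ : Δ ↭ Δ′} {π : G3s (Γ ⊃ Δ)} →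
         Premise π (exch σ τ π)

-- Node π ρ is a path from the root of π to a node whose subproof is ρ, so
-- equal subproofs at different places of π are different nodes.
data Node {S₀} (π : G3s S₀) : ∀ {S} → G3s S → Set where
  root : Node π π
  step : ∀ {S S′} {ρ : G3s S} {ρ′ : G3s S′} →
         Node π ρ → Premise ρ′ ρ → Node π ρ′

------------------------------------------------------------------------
-- Occurrences of □ and their families

data BoxIn : MFm → Set where
  outer  : ∀ {A} → BoxIn (□ A)
  inside : ∀ {A} → BoxIn A → BoxIn (□ A)
  left   : ∀ {A B} → BoxIn A → BoxIn (A ⇒ B)
  right  : ∀ {A B} → BoxIn B → BoxIn (A ⇒ B)

BoxInSeq : Sequent → Set
BoxInSeq (Γ ⊃ Δ) = Any BoxIn Γ ⊎ Any BoxIn Δ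

-- Correspondence from a premise to the conclusion: every □-occurrence of a
-- premise corresponds to exactly one □-occurrence of the conclusion.  In □L
-- the active □ A corresponds to the whole principal formula □ A, the active A
-- to its immediate subformula.
down : ∀ {S′ S} {ρ′ : G3s S′} {ρ : G3s S} →
       Premise ρ′ ρ → BoxInSeq S′ → BoxInSeq S
down ⇒L₁ (inj₁ o)                 = inj₁ (there o)
down ⇒L₁ (inj₂ (here b))          = inj₁ (here (left b))
down ⇒L₁ (inj₂ (there o))         = inj₂ o
down ⇒L₂ (inj₁ (here b))          = inj₁ (here (right b))
down ⇒L₂ (inj₁ (there o))         = inj₁ (there o)
down ⇒L₂ (inj₂ o)                 = inj₂ o
down ⇒R  (inj₁ (here b))          = inj₂ (here (left b))
down ⇒R  (inj₁ (there o))         = inj₁ o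
down ⇒R  (inj₂ (here b))          = inj₂ (here (right b))
down ⇒R  (inj₂ (there o))         = inj₂ (there o)
down □L  (inj₁ (here b))          = inj₁ (here (inside b))
down □L  (inj₁ (there (here b)))  = inj₁ (here b)
down □L  (inj₁ (there (there o))) = inj₁ (there o)
down □L  (inj₂ o)                 = inj₂ o
down (□R {Γ′ = Γ′}) (inj₁ o)      = inj₁ (++⁺ʳ Γ′ o)
down □R  (inj₂ (here b))          = inj₂ (here (inside b))
down (exch {σ = σ}) (inj₁ o)      = inj₁ (Any-resp-↭ σ o)
down (exch {τ = τ}) (inj₂ o)      = inj₂ (Any-resp-↭ τ o)

record BoxOcc {S₀} (π : G3s S₀) : Set where
  constructor occ
  field
    {sequent}  : Sequent
    {subproof} : G3s sequent
    node       : Node π subproof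
    box        : BoxInSeq sequent

data Corresponds {S₀} {π : G3s S₀} : BoxOcc π → BoxOcc π → Set where
  corr : ∀ {S S′} {ρ : G3s S} {ρ′ : G3s S′}
         (n : Node π ρ) (q : Premise ρ′ ρ) (o : BoxInSeq S′) →
         Corresponds (occ (step n q) o) (occ n (down q o))

SameFamily : ∀ {S₀} {π : G3s S₀} → BoxOcc π → BoxOcc π → Set
SameFamily = EqClosure Corresponds

infix 4 _≺_

-- The prehistoric relation on families, each family being given by any one of
-- the occurrences belonging to it.
record _≺_ {S₀} {π : G3s S₀} (i j : BoxOcc π) : Set where
  field
    {A}       : MFm
    {Γ′ Γ Δ′} : List MFm
    {ρ}       : G3s (map □_ Γ ⊃ [ A ])
    node      : Node π (□R Γ′ Γ Δ′ ρ)
    principal : SameFamily j (occ node (inj₂ (here outer)))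
    box       : BoxInSeq (map □_ Γ ⊃ [ A ])
    inPremise : SameFamily i (occ (step node □R) box)

PrehistoricCycleFree : ∀ {S₀} → G3s S₀ → Set
PrehistoricCycleFree π = ¬ Cycle (_≺_ {π = π})

------------------------------------------------------------------------
-- The logic of proofs LP

infixr 7 _∧ᴸ_
infixr 8 _∶_ ¬ᴸ_
infixl 9 _+_
infixl 10 _·_

data Term : Set where
  con     : Const → Term
  var     : Var → Term
  _·_ _+_ : Term → Term → Term
  !_      : Term → Term

data LFm : Set where
  ⊥ᶠ   : LFm
  atom : Atom → LFm
  _⇒_  : LFm → LFm → LFm
  _∶_  : Term → LFm → LFm

¬ᴸ_ : LFm → LFm
¬ᴸ A = A ⇒ ⊥ᶠ

_∧ᴸ_ : LFm → LFm → LFm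
A ∧ᴸ B = ¬ᴸ (A ⇒ ¬ᴸ B)

data LPAxiom : LFm → Set where
  A0  : ∀ {A} → ClassicalAxiom _⇒_ ⊥ᶠ A → LPAxiom A
  A1  : ∀ t F → LPAxiom (t ∶ F ⇒ F)
  A2  : ∀ s t F G → LPAxiom (s ∶ (F ⇒ G) ⇒ (t ∶ F ⇒ (s · t) ∶ G))
  A3  : ∀ t F → LPAxiom (t ∶ F ⇒ (! t) ∶ (t ∶ F))
  A4ˡ : ∀ s t F → LPAxiom (s ∶ F ⇒ (s + t) ∶ F)
  A4ʳ : ∀ s t F → LPAxiom (t ∶ F ⇒ (s + t) ∶ F)

record ConstantSpecification : Set₁ where
  field
    Member  : Const → LFm → Set
    isAxiom : ∀ {c A} → Member c A → LPAxiom A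

open ConstantSpecification public

data LP⟨_⟩⊢_ (CS : ConstantSpecification) : LFm → Set where
  axiom : ∀ {A} → LPAxiom A → LP⟨ CS ⟩⊢ A
  mp    : ∀ {A B} → LP⟨ CS ⟩⊢ (A ⇒ B) → LP⟨ CS ⟩⊢ A → LP⟨ CS ⟩⊢ B
  nec   : ∀ {c A} → Member CS c A → LP⟨ CS ⟩⊢ (con c ∶ A)

data _∈ᵗ_ (c : Const) : Term → Set where
  con : c ∈ᵗ con c
  ·ˡ  : ∀ {s t} → c ∈ᵗ s → c ∈ᵗ (s · t)
  ·ʳ  : ∀ {s t} → c ∈ᵗ t → c ∈ᵗ (s · t)
  +ˡ  : ∀ {s t} → c ∈ᵗ s → c ∈ᵗ (s + t)
  +ʳ  : ∀ {s t} → c ∈ᵗ t → c ∈ᵗ (s + t)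
  !   : ∀ {t} → c ∈ᵗ t → c ∈ᵗ (! t)

data _∈ᶠ_ (c : Const) : LFm → Set where
  ⇒ˡ : ∀ {A B} → c ∈ᶠ A → c ∈ᶠ (A ⇒ B)
  ⇒ʳ : ∀ {A B} → c ∈ᶠ B → c ∈ᶠ (A ⇒ B)
  ∶ˡ : ∀ {t A} → c ∈ᵗ t → c ∈ᶠ (t ∶ A)
  ∶ʳ : ∀ {t A} → c ∈ᶠ A → c ∈ᶠ (t ∶ A)

SelfReferential : ConstantSpecification → Set
SelfReferential CS = Cycle refersTo
  where
  refersTo : (e e′ : Σ[ c ∈ Const ] Σ[ A ∈ LFm ] Member CS c A) → Set
  refersTo (_ , A , _) (c′ , _ , _) = c′ ∈ᶠ A

LP⟨CS⊙⟩⊢_ : LFm → Set₁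
LP⟨CS⊙⟩⊢ B = Σ[ CS ∈ ConstantSpecification ] (¬ SelfReferential CS × LP⟨ CS ⟩⊢ B)

infix 11 _°

_° : LFm → MFm
⊥ᶠ °      = ⊥ᶠ
atom p °  = atom p
(A ⇒ B) ° = A ° ⇒ B °
(t ∶ A) ° = □ (A °)

------------------------------------------------------------------------

NonSelfReferentialDespiteCycles : MFm → LFm → Set₁
NonSelfReferentialDespiteCycles A B =
  (S4⊢ A) ×
  (¬ (∃[ π ] PrehistoricCycleFree {[] ⊃ [ A ]} π)) ×
  (B ° ≡ A) ×
  (LP⟨CS⊙⟩⊢ B)

{-# OPTIONS --safe #-}

-- Both B and A follow from the application axiom, reflexivity and propositional
-- logic alone, so the empty constant specification suffices.
--
-- In a G3s proof of A only the □ of the second ¬ □ P is positive, so only its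
-- family can be principal in (⊃□).  Going up, always choose the right premise
-- at Q ⇒ P and the left premise at every other (⇒⊃), where Q = P ∧ ¬ □ P: the
-- succedent then never contains P, nor the antecedent ⊥, so the branch must
-- reach a (⊃□) with principal formula □ P.  Its premise has boxed antecedents
-- □ (Q ⇒ P) and □ Q only.  Were there no □ Q, it would fail in the one-point
-- reflexive model with P false; and □ Q contains the principal family again.

module Submission where

open import Defs
open import Data.Empty using (⊥; ⊥-elim)
open import Data.Fin using (zero)
open import Data.List using (List; []; _∷_; [_]; map; _++_)
open import Data.List.Relation.Binary.Permutation.Propositional
  using (_↭_; refl; prep; swap; trans; ↭-sym)
open import Data.List.Relation.Binary.Permutation.Propositional.Properties
  using (Any-resp-↭; All-resp-↭)
open import Data.List.Relation.Unary.All using (All; []; _∷_)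
open import Data.List.Relation.Unary.All.Properties using (++⁻ʳ)
open import Data.List.Relation.Unary.Any using (Any; here; there)
open import Data.List.Relation.Unary.Any.Properties using (++⁺ʳ)
open import Data.Product using (∃-syntax; _×_; _,_)
open import Data.Sum using (_⊎_; inj₁; inj₂)
open import Data.Unit using (⊤; tt)
open import Function using (_∘_)
open import Relation.Binary.Construct.Closure.Equivalence
  using (reflexive; symmetric; transitive; return)
open import Relation.Binary.PropositionalEquality using (_≡_; _≢_; refl)
open import Relation.Nullary using (¬_; Dec; yes; no)
open import Relation.Nullary.Decidable using (_→-dec_)

module Hilbert {F : Set} (_⟶_ : F → F → F) (𝟘 : F) (⊢_ : F → Set)
  (classical : ∀ {A} → ClassicalAxiom _⟶_ 𝟘 A → ⊢ A)
  (mp : ∀ {A B} → ⊢ (A ⟶ B) → ⊢ A → ⊢ B)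
  where

  const : ∀ {A B} → ⊢ B → ⊢ (A ⟶ B)
  const = mp (classical (ax-K _ _))

  ap : ∀ {A B C} → ⊢ (A ⟶ (B ⟶ C)) → ⊢ (A ⟶ B) → ⊢ (A ⟶ C)
  ap f = mp (mp (classical (ax-S _ _ _)) f)

  compose : ∀ {A B C} → ⊢ (B ⟶ C) → ⊢ (A ⟶ B) → ⊢ (A ⟶ C)
  compose g = ap (const g)

  precompose : ∀ {A B C} → ⊢ (A ⟶ B) → ⊢ ((B ⟶ C) ⟶ (A ⟶ C))
  precompose f =
    ap (compose (classical (ax-S _ _ _)) (classical (ax-K _ _))) (const f)

  -- Contraposing the `ax-K` instance from `¬ B` to `A ⟶ ¬ B` leaves `¬ ¬ B`.
  ∧-elimʳ : ∀ {A B} → ⊢ (((A ⟶ (B ⟶ 𝟘)) ⟶ 𝟘) ⟶ B)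
  ∧-elimʳ =
    compose (classical (ax-DNE _)) (precompose (classical (ax-K _ _)))

  -- Serves both logics: `f` is distribution or the application axiom, `g` is reflexivity. Under
  -- `X`, the right conjunct supplied by `g` refutes the `Z` that `f` derives from `Y`.
  refute-conjunction : ∀ {A X Y Z} →
    ⊢ (Y ⟶ (X ⟶ Z)) → ⊢ (X ⟶ ((A ⟶ ((Z ⟶ 𝟘) ⟶ 𝟘)) ⟶ 𝟘)) →
    ⊢ (Y ⟶ (X ⟶ 𝟘))
  refute-conjunction f g =
    compose (mp (classical (ax-S _ _ _)) (compose ∧-elimʳ g)) f

∅-CS : ConstantSpecification
∅-CS = record { Member = λ _ _ → ⊥ ; isAxiom = λ () }

∅-CS-not-self-referential : ¬ SelfReferential ∅-CS
∅-CS-not-self-referential (_ , e , _) with e zero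
... | _ , _ , ()

-- Truth in the one-point reflexive model with all atoms false.
⟦_⟧ : MFm → Set
⟦ ⊥ᶠ ⟧     = ⊥
⟦ atom _ ⟧ = ⊥
⟦ A ⇒ B ⟧  = ⟦ A ⟧ → ⟦ B ⟧
⟦ □ A ⟧    = ⟦ A ⟧

-- Supplies the case distinction that the multi-succedent rule `⇒R` requires in `sound`.
⟦⟧-dec : ∀ A → Dec ⟦ A ⟧
⟦⟧-dec ⊥ᶠ       = no λ ()
⟦⟧-dec (atom _) = no λ ()
⟦⟧-dec (A ⇒ B)  = ⟦⟧-dec A →-dec ⟦⟧-dec B
⟦⟧-dec (□ A)    = ⟦⟧-dec A

sound : ∀ {Γ Δ} → G3s (Γ ⊃ Δ) → All ⟦_⟧ Γ → Any ⟦_⟧ Δ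
sound ax (() ∷ _)
sound ⊥L (() ∷ _)
sound (⇒L π₁ π₂) (f ∷ γ) with sound π₁ γ
... | here a  = sound π₂ (f a ∷ γ)
... | there δ = δ
sound (⇒R {A = A} π) γ with ⟦⟧-dec A
... | no ¬a = here (⊥-elim ∘ ¬a)
... | yes a with sound π (a ∷ γ)
...   | here b  = here λ _ → b
...   | there δ = there δ
sound (□L π) (a ∷ γ) = sound π (a ∷ a ∷ γ)
sound (□R Γ′ _ _ π) γ with sound π (++⁻ʳ Γ′ γ)
... | here a = here a
sound (exch σ τ π) γ = Any-resp-↭ τ (sound π (All-resp-↭ (↭-sym σ) γ))

-- As `down` is a function, each family is represented by an occurrence in the
-- end-sequent.
trace : ∀ {S₀ S} {π : G3s S₀} {ρ : G3s S} → Node π ρ → BoxInSeq S → BoxInSeq S₀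
trace root       o = o
trace (step n q) o = trace n (down q o)

trace-sameFamily : ∀ {S₀ S} {π : G3s S₀} {ρ : G3s S} (n : Node π ρ) (o : BoxInSeq S) →
  SameFamily (occ {π = π} root (trace n o)) (occ n o)
trace-sameFamily root       o = reflexive Corresponds
trace-sameFamily (step n q) o =
  transitive Corresponds (trace-sameFamily n (down q o))
    (symmetric Corresponds (return (corr n q o)))

module _ {O : Set} where

  -- The map BoxIn A → O says where the □s of this occurrence of A belong; below
  -- it sends each of them to its trace in the end-sequent.
  Located : Set₁
  Located = (A : MFm) → (BoxIn A → O) → Set

  AllLocated : Located → (Γ : List MFm) → (Any BoxIn Γ → O) → Set
  AllLocated P []      e = ⊤
  AllLocated P (A ∷ Γ) e = P A (e ∘ here) × AllLocated P Γ (e ∘ there)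

  AllLocated-resp-↭ : ∀ {P : Located} {Γ Γ′} (σ : Γ ↭ Γ′) {e} →
    AllLocated P Γ′ e → AllLocated P Γ (e ∘ Any-resp-↭ σ)
  AllLocated-resp-↭     refl         ps           = ps
  AllLocated-resp-↭ {P} (prep _ σ)   (p , ps)     = p , AllLocated-resp-↭ {P} σ ps
  AllLocated-resp-↭ {P} (swap _ _ σ) (p , q , ps) = q , p , AllLocated-resp-↭ {P} σ ps
  AllLocated-resp-↭ {P} (trans σ τ)  ps           =
    AllLocated-resp-↭ {P} σ (AllLocated-resp-↭ {P} τ ps)

  AllLocated-++⁻ʳ : ∀ {P : Located} Γ′ {Γ e} →
    AllLocated P (Γ′ ++ Γ) e → AllLocated P Γ (e ∘ ++⁺ʳ Γ′)
  AllLocated-++⁻ʳ []                ps       = ps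
  AllLocated-++⁻ʳ {P} (_ ∷ Γ′) (_ , ps) = AllLocated-++⁻ʳ {P} Γ′ ps

module _ (p : Atom) where

  private
    P Q A : MFm
    P = atom p
    Q = P ∧ᴹ ¬ᴹ □ P
    A = □ (Q ⇒ P) ⇒ ¬ᴹ □ Q

  boxInQ : BoxIn Q
  boxInQ = left (right (left (left outer)))

  principalBox : BoxInSeq ([] ⊃ [ A ])
  principalBox = inj₂ (here (right (left (inside boxInQ))))

  -- The formulas met on the branch.  Those coming from □ Q record that their
  -- □ P lies in the principal family.
  data Antecedent : Located {BoxInSeq ([] ⊃ [ A ])} where
    P-   : ∀ {e} → Antecedent P e
    □QP- : ∀ {e} → Antecedent (□ (Q ⇒ P)) e
    QP-  : ∀ {e} → Antecedent (Q ⇒ P) e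
    □Q-  : ∀ {e} → e (inside boxInQ) ≡ principalBox → Antecedent (□ Q) e
    Q-   : ∀ {e} → e boxInQ ≡ principalBox → Antecedent Q e
    ¬□P- : ∀ {e} → e (left outer) ≡ principalBox → Antecedent (¬ᴹ □ P) e

  data Succedent : Located {BoxInSeq ([] ⊃ [ A ])} where
    A-      : ∀ {e} → e (right (left (inside boxInQ))) ≡ principalBox →
              Succedent A e
    ¬□Q-    : ∀ {e} → e (left (inside boxInQ)) ≡ principalBox →
              Succedent (¬ᴹ □ Q) e
    P⇒¬¬□P- : ∀ {e} → e (right (left (left outer))) ≡ principalBox →
              Succedent (P ⇒ ¬ᴹ ¬ᴹ □ P) e
    ¬¬□P-   : ∀ {e} → e (left (left outer)) ≡ principalBox →
              Succedent (¬ᴹ ¬ᴹ □ P) e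
    ⊥-      : ∀ {e} → Succedent ⊥ᶠ e
    □P-     : ∀ {e} → e outer ≡ principalBox → Succedent (□ P) e

  boxed-antecedent : ∀ Γ {e} → AllLocated Antecedent (map □_ Γ) e →
    (∃[ o ] e o ≡ principalBox) ⊎ All ⟦_⟧ (map □_ Γ)
  boxed-antecedent []      _              = inj₂ []
  boxed-antecedent (_ ∷ Γ) (□Q- eq , _)   = inj₁ (_ , eq)
  boxed-antecedent (_ ∷ Γ) (□QP- , γ) with boxed-antecedent Γ γ
  ... | inj₁ (o , eq) = inj₁ (there o , eq)
  -- As `P` is false, `P ⇒ ¬ᴹ ¬ᴹ □ P` holds vacuously, so `Q` fails and `Q ⇒ P` is true.
  ... | inj₂ ⊨Γ       = inj₂ ((λ q → q λ ()) ∷ ⊨Γ)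

  module _ (π : G3sProof A) where

    principalOcc : BoxOcc π
    principalOcc = occ root principalBox

    sameFamily-principal : ∀ {S} {ρ : G3s S} (n : Node π ρ) (o : BoxInSeq S) →
      trace n o ≡ principalBox → SameFamily principalOcc (occ n o)
    sameFamily-principal n o eq with trace n o | trace-sameFamily n o
    sameFamily-principal n o refl | _ | s = s

    -- Structural recursion on `ρ`. Since `trace (step n q) o` unfolds to `trace n (down q o)`, each
    -- `eq` passes unchanged to the premise.
    branch : ∀ {Γ Δ} (ρ : G3s (Γ ⊃ Δ)) (n : Node π ρ) →
      AllLocated Antecedent Γ (trace n ∘ inj₁) →
      AllLocated Succedent Δ (trace n ∘ inj₂) →
      principalOcc ≺ principalOcc
    branch ax n _ (() , _)
    branch ⊥L n (() , _) _
    -- The left premise would put `Q` into the succedent, from where `P` could get there too and let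
    -- `ax` close the branch.
    branch (⇒L ρ₁ ρ₂) n (QP- , γ)     δ = branch ρ₂ (step n ⇒L₂) (P- , γ) δ
    branch (⇒L ρ₁ ρ₂) n (Q- eq , γ)   δ = branch ρ₁ (step n ⇒L₁) γ (P⇒¬¬□P- eq , δ)
    branch (⇒L ρ₁ ρ₂) n (¬□P- eq , γ) δ = branch ρ₁ (step n ⇒L₁) γ (□P- eq , δ)
    branch (⇒R ρ) n γ (A- eq , δ)      = branch ρ (step n ⇒R) (□QP- , γ) (¬□Q- eq , δ)
    branch (⇒R ρ) n γ (¬□Q- eq , δ)    = branch ρ (step n ⇒R) (□Q- eq , γ) (⊥- , δ)
    branch (⇒R ρ) n γ (P⇒¬¬□P- eq , δ) = branch ρ (step n ⇒R) (P- , γ) (¬¬□P- eq , δ)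
    branch (⇒R ρ) n γ (¬¬□P- eq , δ)   = branch ρ (step n ⇒R) (¬□P- eq , γ) (⊥- , δ)
    branch (□L ρ) n (□QP- , γ)   δ = branch ρ (step n □L) (QP- , □QP- , γ) δ
    -- One `eq` serves both active formulas: `down` sends the `□ P` of `Q` and that of the kept
    -- `□ Q` to the same box.
    branch (□L ρ) n (□Q- eq , γ) δ = branch ρ (step n □L) (Q- eq , □Q- eq , γ) δ
    branch (□R Γ′ Γ _ ρ) n γ (□P- eq , _)
      with boxed-antecedent Γ (AllLocated-++⁻ʳ {P = Antecedent} Γ′ γ)
    ... | inj₁ (o , eq′) = record
      { node      = n
      ; principal = sameFamily-principal n (inj₂ (here outer)) eq
      ; box       = inj₁ o
      ; inPremise = sameFamily-principal (step n □R) (inj₁ o) eq′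
      }
    ... | inj₂ ⊨Γ with sound ρ ⊨Γ
    ...   | here ()
    ...   | there ()
    branch (exch σ τ ρ) n γ δ =
      branch ρ (step n exch) (AllLocated-resp-↭ {P = Antecedent} σ γ)
        (AllLocated-resp-↭ {P = Succedent} τ δ)

    prehistoric-cycle : Cycle (_≺_ {π = π})
    prehistoric-cycle =
      -- `0` encodes a cycle of length one. At `root` the trace is the identity, whence `refl`.
      0 , (λ _ → principalOcc) , λ _ → branch π root tt (A- refl , tt)

theorem-for : (p : Atom) (x y : Var) →
  NonSelfReferentialDespiteCycles
    (□ (atom p ∧ᴹ ¬ᴹ □ atom p ⇒ atom p) ⇒ ¬ᴹ □ (atom p ∧ᴹ ¬ᴹ □ atom p))
    (var y ∶ (atom p ∧ᴸ ¬ᴸ (var y · var x) ∶ atom p ⇒ atom p)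
      ⇒ ¬ᴸ var x ∶ (atom p ∧ᴸ ¬ᴸ (var y · var x) ∶ atom p))
theorem-for p x y =
    S4.refute-conjunction (distr _ _) (refl _)
  , (λ (π , cycle-free) → cycle-free (prehistoric-cycle p π))
  , refl
  , ∅-CS , ∅-CS-not-self-referential
  , LP.refute-conjunction (axiom (A2 _ _ _ _)) (axiom (A1 _ _))
  where
  module S4 = Hilbert _⇒_ ⊥ᶠ S4⊢_ classical mp
  module LP = Hilbert _⇒_ ⊥ᶠ LP⟨ ∅-CS ⟩⊢_ (axiom ∘ A0) mp

mainTheorem11 : (∃[ A ] ∃[ B ] NonSelfReferentialDespiteCycles A B) ×
    ((p : Atom) (x y : Var) → x ≢ y →
    NonSelfReferentialDespiteCycles
    (□ (atom p ∧ᴹ ¬ᴹ □ atom p ⇒ atom p) ⇒ ¬ᴹ □ (atom p ∧ᴹ ¬ᴹ □ atom p))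
    (var y ∶ (atom p ∧ᴸ ¬ᴸ (var y · var x) ∶ atom p ⇒ atom p)
    ⇒ ¬ᴸ var x ∶ (atom p ∧ᴸ ¬ᴸ (var y · var x) ∶ atom p)))
mainTheorem11 = (_ , _ , theorem-for 0 0 1) , λ p x y _ → theorem-for p x y
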